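{- For every integer $m \geq 4$, the number $\ell(m)$ of indecomposable solutions of $(\mathrm{C}_m)$ satisfies $$\ell(m) \leq \sum_{s=1}^{\mathsf{SD}(m)} \binom{m-1}{s,\; s-1,\; m-2s},$$ a sum of trinomial coefficients. In particular $\ell(m) < 3^{m-1}$ for every integer $m \geq 2$.
   Context: $\mathbb{N} = \{0,1,2,\ldots\}$. For an integer $m \geq 2$, $(\mathrm{C}_m)$ denotes the congruence $1\cdot x_1 + 2\cdot x_2 + \cdots + (m-1)\cdot x_{m-1} \equiv 0 \pmod m$ for unknown $x = (x_1,\ldots,x_{m-1}) \in \mathbb{N}^{m-1}$. A solution is indecomposable if it is nonzero and minimal among the nonzero solutions in $\mathbb{N}^{m-1}$ with respect to the componentwise order; $\ell(m)$ is the number of indecomposable solutions of $(\mathrm{C}_m)$. The width of $x$ is $\sigma(x) = \#\{i : x_i \neq 0\}$, and $\mathsf{SD}(m) = \max\{\sigma(x) : x \text{ is an indecomposable solution of } (\mathrm{C}_m)\}$. The trinomial coefficient is $\binom{n}{p,q,r} = \frac{n!}{p!\,q!\,r!}$ for $p,q,r \in \mathbb{N}$ with $p+q+r=n$. (For $m \geq 4$ one has $2\,\mathsf{SD}(m) \leq m$, so all trinomial coefficients in the sum are defined.) -}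

module Defs where

open import Data.Fin.Base using (Fin; zero; suc; toℕ)
open import Data.List.Base as List using (List; []; _∷_)
open import Data.List.Extrema.Nat using (max)
open import Data.List.Membership.Propositional using (_∈_)
open import Data.List.Membership.Propositional.Properties
  using (∈-cartesianProductWith⁺; ∈-cartesianProductWith⁻; ∈-upTo⁺; ∈-upTo⁻; ∈-filter⁺; ∈-filter⁻)
import Data.List.Relation.Unary.All as All
open import Data.List.Relation.Unary.Any using (here)
import Data.List.Relation.Unary.AllPairs as AllPairs
open import Data.List.Relation.Unary.Unique.Propositional using (Unique)
import Data.List.Relation.Unary.Unique.Propositional.Properties as Unique
open import Data.Nat.Base
open import Data.Nat.ListAction using (sum)
open import Data.Nat.Properties
open import Data.Nat.Divisibility using (_∣_; _∣?_; _∣0; ∣-refl; ∣m∣n⇒∣m+n; ∣n⇒∣m*n)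
open import Data.Product.Base using (_×_; _,_; proj₂)
open import Data.Vec.Base as Vec using (Vec; []; _∷_)
open import Data.Vec.Properties as Vec using (≡-dec; ∷-injective)
open import Data.Vec.Relation.Binary.Pointwise.Inductive as Pointwise using (Pointwise; []; _∷_)
open import Function.Base using (_∘_)
open import Function.Bundles using (_⇔_; mk⇔)
open import Relation.Binary.PropositionalEquality using (_≡_; _≢_; refl; sym; trans; cong)
open import Relation.Nullary using (Dec; yes; no; ¬?; _×-dec_; _→-dec_)
open import Relation.Nullary.Decidable using (map′)

-- The unknown x = (x₁, …, xₘ₋₁); position i : Fin (m ∸ 1) holds x₍ᵢ₊₁₎.
Tuple : ℕ → Set
Tuple m = Vec ℕ (m ∸ 1)

𝟘 : ∀ {n} → Vec ℕ n
𝟘 = Vec.replicate _ 0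

weightedSum : ∀ {n} → Vec ℕ n → ℕ
weightedSum x = Vec.sum (Vec.tabulate λ i → suc (toℕ i) * Vec.lookup x i)

Solution : (m : ℕ) → Tuple m → Set
Solution m x = m ∣ weightedSum x

infix 4 _≤ᵥ_
_≤ᵥ_ : ∀ {n} → Vec ℕ n → Vec ℕ n → Set
_≤ᵥ_ = Pointwise _≤_

Indecomposable : (m : ℕ) → Tuple m → Set
Indecomposable m x =
  Solution m x × x ≢ 𝟘 × (∀ y → Solution m y → y ≢ 𝟘 → y ≤ᵥ x → y ≡ x)

σ : ∀ {n} → Vec ℕ n → ℕ
σ = Vec.count (λ k → ¬? (k ≟ 0))

-- All vectors componentwise below a given one, each listed once.
below : ∀ {n} → Vec ℕ n → List (Vec ℕ n)
below []      = [] ∷ []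
below (k ∷ x) = List.cartesianProductWith _∷_ (List.upTo (suc k)) (below x)

∈-below⁺ : ∀ {n} {x y : Vec ℕ n} → y ≤ᵥ x → y ∈ below x
∈-below⁺ []       = here refl
∈-below⁺ (p ∷ ps) = ∈-cartesianProductWith⁺ _∷_ (∈-upTo⁺ (s≤s p)) (∈-below⁺ ps)

∈-below⁻ : ∀ {n} (x : Vec ℕ n) {y} → y ∈ below x → y ≤ᵥ x
∈-below⁻ []      (here refl) = []
∈-below⁻ (k ∷ x) y∈ with ∈-cartesianProductWith⁻ _∷_ (List.upTo (suc k)) (below x) y∈
... | _ , _ , a∈ , b∈ , refl = s≤s⁻¹ (∈-upTo⁻ a∈) ∷ ∈-below⁻ x b∈

below-unique : ∀ {n} (x : Vec ℕ n) → Unique (below x)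
below-unique []      = All.[] AllPairs.∷ AllPairs.[]
below-unique (k ∷ x) =
  Unique.cartesianProductWith⁺ _∷_ ∷-injective (Unique.upTo⁺ (suc k)) (below-unique x)

indecomposable? : ∀ m (x : Tuple m) → Dec (Indecomposable m x)
indecomposable? m x = (m ∣? weightedSum x) ×-dec nonzero? x ×-dec minimal?
  where
  nonzero? : (y : Tuple m) → Dec (y ≢ 𝟘)
  nonzero? y = ¬? (≡-dec _≟_ y 𝟘)

  minimal? : Dec (∀ y → Solution m y → y ≢ 𝟘 → y ≤ᵥ x → y ≡ x)
  minimal? = map′
    (λ h y sol nz y≤x → All.lookup h (∈-below⁺ y≤x) sol nz)
    (λ h → All.tabulate λ {y} y∈ sol nz → h y sol nz (∈-below⁻ x y∈))
    (All.all? (λ y → (m ∣? weightedSum y) →-dec nonzero? y →-dec ≡-dec _≟_ y x) (below x))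

indecomposables : (m : ℕ) → List (Tuple m)
indecomposables m = List.filter (indecomposable? m) (below (Vec.replicate _ m))

ℓ : ℕ → ℕ
ℓ m = List.length (indecomposables m)

SD : ℕ → ℕ
SD m = max 0 (List.map σ (indecomposables m))

-- The search box {0, …, m}ᵐ⁻¹ misses no indecomposable solution: if xᵢ > m, then
-- m times the i-th unit vector is a nonzero solution strictly below x.

spike : ∀ {n} → ℕ → Fin n → Vec ℕ n
spike {suc n} k zero    = k ∷ 𝟘
spike {suc n} k (suc i) = 0 ∷ spike k i

lookup-spike : ∀ {n} k (i : Fin n) → Vec.lookup (spike k i) i ≡ k
lookup-spike k zero    = refl
lookup-spike k (suc i) = lookup-spike k i

∣-spike : ∀ {n} k (i j : Fin n) → k ∣ Vec.lookup (spike k i) j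
∣-spike k zero    zero    = ∣-refl
∣-spike k zero    (suc j) rewrite Vec.lookup-replicate j 0 = k ∣0
∣-spike k (suc i) zero    = k ∣0
∣-spike k (suc i) (suc j) = ∣-spike k i j

spike-≤ : ∀ {n} k (i : Fin n) (x : Vec ℕ n) → k ≤ Vec.lookup x i → spike k i ≤ᵥ x
spike-≤ k zero    (_ ∷ x) k≤ = k≤ ∷ 𝟘≤ x
  where
  𝟘≤ : ∀ {n} (y : Vec ℕ n) → 𝟘 ≤ᵥ y
  𝟘≤ []      = []
  𝟘≤ (_ ∷ y) = z≤n ∷ 𝟘≤ y
spike-≤ k (suc i) (_ ∷ x) k≤ = z≤n ∷ spike-≤ k i x k≤

∣-sum-tabulate : ∀ {n d} (f : Fin n → ℕ) → (∀ i → d ∣ f i) → d ∣ Vec.sum (Vec.tabulate f)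
∣-sum-tabulate {zero}  {d} f d∣f = d ∣0
∣-sum-tabulate {suc n} f d∣f = ∣m∣n⇒∣m+n (d∣f zero) (∣-sum-tabulate (f ∘ suc) (d∣f ∘ suc))

lookup-indecomposable-≤ : ∀ m {x} → Indecomposable m x → ∀ i → Vec.lookup x i ≤ m
lookup-indecomposable-≤ m@(suc _) {x} (_ , _ , minimal) i = ≮⇒≥ λ m<xᵢ →
  <-irrefl
    (trans (sym (lookup-spike m i))
           (cong (λ v → Vec.lookup v i)
             (minimal (spike m i) spike-solution spike≢𝟘 (spike-≤ m i x (<⇒≤ m<xᵢ)))))
    m<xᵢ
  where
  spike-solution : Solution m (spike m i)
  spike-solution = ∣-sum-tabulate (λ j → suc (toℕ j) * Vec.lookup (spike m i) j)
                     (λ j → ∣n⇒∣m*n (suc (toℕ j)) (∣-spike m i j))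

  spike≢𝟘 : spike m i ≢ 𝟘
  spike≢𝟘 eq = 1+n≢0 (trans (sym (lookup-spike m i))
    (trans (cong (λ v → Vec.lookup v i) eq) (Vec.lookup-replicate i 0)))

∈-indecomposables⇔ : ∀ m {x} → x ∈ indecomposables m ⇔ Indecomposable m x
∈-indecomposables⇔ m = mk⇔
  (λ x∈ → proj₂ (∈-filter⁻ (indecomposable? m) {xs = below (Vec.replicate _ m)} x∈))
  (λ ind → ∈-filter⁺ (indecomposable? m)
             (∈-below⁺ (≤-replicate _ (lookup-indecomposable-≤ m ind))) ind)
  where
  ≤-replicate : ∀ {n k} (x : Vec ℕ n) → (∀ i → Vec.lookup x i ≤ k) → x ≤ᵥ Vec.replicate n k
  ≤-replicate []      h = []
  ≤-replicate (_ ∷ x) h = h zero ∷ ≤-replicate x (h ∘ suc)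

indecomposables-unique : ∀ m → Unique (indecomposables m)
indecomposables-unique m =
  Unique.filter⁺ (indecomposable? m) (below-unique (Vec.replicate _ m))

-- n! / (p! q! r!) when p + q + r ≡ n. The value 0 elsewhere is a convention for
-- arguments at which the coefficient is undefined; because of it, writing
-- m ∸ 2 * s for m − 2s cannot create a spurious term when 2s > m.
trinomial : (n p q r : ℕ) → ℕ
trinomial n p q r with p + q + r ≟ n
... | yes _ = (n ! / (p ! * q ! * r !)) {{m*n≢0 (p ! * q !) (r !) {{p !* q !≢0}} {{r !≢0}}}}
... | no  _ = 0

sumFrom1To : ℕ → (ℕ → ℕ) → ℕ
sumFrom1To n f = sum (List.applyUpTo (f ∘ suc) n)

{-# OPTIONS --safe #-}
-- Let x be an indecomposable solution of width s and sum S. Two subvectors y ≤ z of x whose sums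
-- differ by neither 0 nor S have distinct weights modulo m, for otherwise z − y would be a smaller
-- solution. Let u be the indicator vector of the support of x. The subvectors 0 and eᵢ (xᵢ ≠ 0),
-- their mirror images u and u − eᵢ, and a maximal chain strictly between u and x then represent
-- distinct residues, except that r and u − r may agree; this happens for at most two of the s + 1
-- vectors r, as 2i ≡ c (mod m) has at most two solutions. Counting residues gives S + s ≤ m + 1,
-- and S + s ≤ m if S = s. Hence each x can be moved, within its support, to a vector of width s
-- and sum m − s: raise a coordinate if S + s ≤ m, and subtract some eᵢ with xᵢ ≥ 2 if S + s = m + 1.
-- This is injective because the indecomposable solutions form an antichain and distinct eᵢ have
-- distinct weights. There are C(m−1, s) C(m−s−1, s−1) such vectors, which is the trinomial
-- coefficient; it is at most C(m−1, s) 2^(m−1−s), and the terms s ≥ 1 of the expansion of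
-- (1 + 2)^(m−1) add up to less than 3^(m−1).
module Submission where

open import Defs
open import Data.Nat.Base using (ℕ; _∸_; _*_; _^_; _≤_; _<_)
open import Data.Product.Base using (_×_)
import Algebra.Properties.CommutativeSemigroup as CommSemigroup
open import Data.Fin.Base using (Fin; zero; suc; toℕ)
open import Data.Fin.Properties as Fin using (toℕ<n; toℕ-injective)
open import Data.List.Base as List
  using (List; []; _∷_; _++_; length; filter; upTo; applyUpTo; concat)
open import Data.List.Extrema.Nat using (xs≤max)
open import Data.List.Membership.Propositional using (_∈_)
open import Data.List.Membership.Propositional.Properties
open import Data.List.Properties using (length-++; length-map; length-upTo; length-applyUpTo)
open import Data.List.Relation.Binary.Disjoint.Propositional using (Disjoint)
open import Data.List.Relation.Binary.Subset.Propositional using (_⊆_)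
open import Data.List.Relation.Unary.All as All using ()
open import Data.List.Relation.Unary.AllPairs using ([]; _∷_)
open import Data.List.Relation.Unary.Any using (here; there)
open import Data.List.Relation.Unary.Unique.Propositional using (Unique)
import Data.List.Relation.Unary.Unique.Propositional.Properties as Unique
open import Data.Nat.Base hiding (ℕ; _∸_; _*_; _^_; _≤_; _<_)
open import Data.Nat.Combinatorics
open import Data.Nat.Divisibility
open import Data.Nat.DivMod
open import Data.Nat.ListAction using (sum)
open import Data.Nat.Properties
open import Data.Product.Base using (_,_; proj₁; proj₂; ∃)
open import Data.Sum.Base using (inj₁; inj₂; [_,_]′)
open import Data.Vec.Base as Vec using (Vec; []; _∷_; zipWith; lookup)
open import Data.Vec.Properties using (∷-injective)
open import Data.Vec.Relation.Binary.Pointwise.Inductive as Pointwise using ([]; _∷_)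
open import Function.Base using (_∘_)
open import Function.Bundles using (Equivalence)
open import Level using (0ℓ)
open import Relation.Binary.Definitions using (tri<; tri≈; tri>)
open import Relation.Binary.PropositionalEquality
open import Relation.Nullary using (¬_; Dec; yes; no; ¬?; contradiction)
open import Relation.Nullary.Decidable using (toWitness)
open import Relation.Unary using (Pred; Decidable)

private variable
  A B : Set
  n : ℕ

-- Counting lists through injections.

map⁺-∈ : ∀ (f : A → B) {xs} → (∀ {x y} → x ∈ xs → y ∈ xs → f x ≡ f y → x ≡ y) →
         Unique xs → Unique (List.map f xs)
map⁺-∈ f         inj []           = []
map⁺-∈ f {x ∷ _} inj (x∉xs ∷ xs!) =
  All.tabulate (λ y∈ fx≡y → let z , z∈ , y≡fz = ∈-map⁻ f y∈ in
    All.lookup x∉xs z∈ (inj (here refl) (there z∈) (trans fx≡y y≡fz)))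
  ∷ map⁺-∈ f (λ x∈ y∈ → inj (there x∈) (there y∈)) xs!

-- Induction on `xs`: one occurrence of the head is cut out of `ys`, and by uniqueness the tail
-- stays inside what remains.
Unique∧⊆⇒length≤ : ∀ {xs ys : List A} → Unique xs → xs ⊆ ys → length xs ≤ length ys
Unique∧⊆⇒length≤ {xs = []}     _            _     = z≤n
Unique∧⊆⇒length≤ {xs = x ∷ xs} (x∉xs ∷ xs!) xs⊆ys
  with as , bs , refl ← ∈-∃++ (xs⊆ys (here refl)) = begin
  suc (length xs)            ≤⟨ s≤s (Unique∧⊆⇒length≤ xs! xs⊆as++bs) ⟩
  suc (length (as ++ bs))    ≡⟨ cong suc (length-++ as) ⟩
  suc (length as + length bs) ≡⟨ +-suc (length as) (length bs) ⟨
  length as + suc (length bs) ≡⟨ length-++ as ⟨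
  length (as ++ x ∷ bs)      ∎
  where
  open ≤-Reasoning
  xs⊆as++bs : xs ⊆ as ++ bs
  xs⊆as++bs y∈ with ∈-++⁻ as (xs⊆ys (there y∈))
  ... | inj₁ y∈as         = ∈-++⁺ˡ y∈as
  ... | inj₂ (here refl)  = contradiction refl (All.lookup x∉xs y∈)
  ... | inj₂ (there y∈bs) = ∈-++⁺ʳ as y∈bs

-- Injectivity is asked only between members of `xs`, because the map `level` is shown injective on
-- indecomposable solutions only.
injective⇒length≤ : ∀ (f : A → B) {xs ys} → (∀ {x y} → x ∈ xs → y ∈ xs → f x ≡ f y → x ≡ y) →
                    Unique xs → (∀ {x} → x ∈ xs → f x ∈ ys) → length xs ≤ length ys
injective⇒length≤ f {xs} {ys} inj xs! into = subst (_≤ length ys) (length-map f xs)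
  (Unique∧⊆⇒length≤ (map⁺-∈ f inj xs!)
    λ y∈ → let _ , x∈ , y≡fx = ∈-map⁻ f y∈ in subst (_∈ ys) (sym y≡fx) (into x∈))

length-filter-∁ : ∀ {P : Pred A 0ℓ} (P? : Decidable P) xs →
                  length (filter P? xs) + length (filter (¬? ∘ P?) xs) ≡ length xs
length-filter-∁ P? []       = refl
length-filter-∁ P? (x ∷ xs) with P? x
... | yes _ = cong suc (length-filter-∁ P? xs)
... | no  _ = trans (+-suc _ _) (cong suc (length-filter-∁ P? xs))

-- Congruences modulo `d`.

[m+n]%d≡m%d⇒d∣n : ∀ m n d .{{_ : NonZero d}} → (m + n) % d ≡ m % d → d ∣ n
[m+n]%d≡m%d⇒d∣n m n d eq = ∣m+n∣m⇒∣n
  (divides ((m + n) / d) (+-cancelˡ-≡ (m % d) _ _ (begin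
    m % d + (m / d * d + n)      ≡⟨ +-assoc (m % d) _ n ⟨
    m % d + m / d * d + n        ≡⟨ cong (_+ n) (m≡m%n+[m/n]*n m d) ⟨
    m + n                        ≡⟨ m≡m%n+[m/n]*n (m + n) d ⟩
    (m + n) % d + (m + n) / d * d ≡⟨ cong (_+ (m + n) / d * d) eq ⟩
    m % d + (m + n) / d * d       ∎)))
  (n∣m*n (m / d))
  where open ≡-Reasoning

%-cancelʳ-< : ∀ {i j} k d .{{_ : NonZero d}} → i < d → j < d →
              (i + k) % d ≡ (j + k) % d → i ≡ j
%-cancelʳ-< {i} {j} k d i<d j<d eq =
  [ (λ i≤j → ordered i≤j j<d eq) , (λ j≤i → sym (ordered j≤i i<d (sym eq))) ]′ (≤-total i j)
  where
  open ≡-Reasoning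

  ordered : ∀ {i j} → i ≤ j → j < d → (i + k) % d ≡ (j + k) % d → i ≡ j
  ordered {i} {j} i≤j j<d eq with j ∸ i in j∸i
  ... | zero  = ≤-antisym i≤j (m∸n≡0⇒m≤n j∸i)
  -- A positive difference of `i` and `j` would be a multiple of `d`, yet it is at most `j < d`.
  ... | suc l = contradiction (∣⇒≤ ([m+n]%d≡m%d⇒d∣n (i + k) (suc l) d (begin
      (i + k + suc l) % d   ≡⟨ cong (_% d) (trans (+-assoc i k _) (cong (i +_) (+-comm k _))) ⟩
      (i + (suc l + k)) % d ≡⟨ cong (_% d) (+-assoc i _ k) ⟨
      (i + suc l + k) % d   ≡⟨ cong (λ l → (i + l + k) % d) j∸i ⟨
      (i + (j ∸ i) + k) % d ≡⟨ cong (λ j → (j + k) % d) (m+[n∸m]≡n i≤j) ⟩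
      (j + k) % d           ≡⟨ eq ⟨
      (i + k) % d           ∎)))
    (<⇒≱ (≤-<-trans (subst (_≤ j) j∸i (m∸n≤m j i)) j<d))

-- Once the remainder of 2i is fixed, i is determined by the quotient of 2i by `d`, and this
-- quotient is 0 or 1 since 2i < 2d.
length-halves≤2 : ∀ c d .{{_ : NonZero d}} {is : List (Fin d)} → Unique is →
                  (∀ {i} → i ∈ is → (toℕ i + toℕ i) % d ≡ c) → length is ≤ 2
length-halves≤2 c d is! halves = injective⇒length≤ (λ i → (toℕ i + toℕ i) / d) {ys = upTo 2}
  (λ i∈ j∈ quot≡ → toℕ-injective (double-injective (begin
    _ ≡⟨ m≡m%n+[m/n]*n _ d ⟩
    _ ≡⟨ cong₂ (λ r q → r + q * d) (trans (halves i∈) (sym (halves j∈))) quot≡ ⟩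
    _ ≡⟨ m≡m%n+[m/n]*n _ d ⟨
    _ ∎)))
  is!
  (λ {i} _ → ∈-upTo⁺ (m<n*o⇒m/o<n (subst (toℕ i + toℕ i <_) (cong (d +_) (sym (+-identityʳ d)))
    (+-mono-< (toℕ<n i) (toℕ<n i)))))
  where
  open ≡-Reasoning
  double-injective : ∀ {i j} → i + i ≡ j + j → i ≡ j
  double-injective {i} {j} eq with <-cmp i j
  ... | tri< i<j _ _ = contradiction eq (<⇒≢ (+-mono-< i<j i<j))
  ... | tri≈ _ i≡j _ = i≡j
  ... | tri> _ _ j<i = contradiction (sym eq) (<⇒≢ (+-mono-< j<i j<i))

-- Componentwise arithmetic, sums and weights.

infixl 6 _⊕_ _⊖_
_⊕_ _⊖_ : Vec ℕ n → Vec ℕ n → Vec ℕ n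
_⊕_ = zipWith _+_
_⊖_ = zipWith _∸_

≤ᵥ-refl : {x : Vec ℕ n} → x ≤ᵥ x
≤ᵥ-refl = Pointwise.refl ≤-refl

≤ᵥ-trans : {x y z : Vec ℕ n} → x ≤ᵥ y → y ≤ᵥ z → x ≤ᵥ z
≤ᵥ-trans = Pointwise.trans ≤-trans

𝟘≤ : (x : Vec ℕ n) → 𝟘 ≤ᵥ x
𝟘≤ []      = []
𝟘≤ (_ ∷ x) = z≤n ∷ 𝟘≤ x

⊕-identityˡ : (x : Vec ℕ n) → 𝟘 ⊕ x ≡ x
⊕-identityˡ []      = refl
⊕-identityˡ (a ∷ x) = cong (a ∷_) (⊕-identityˡ x)

⊕-identityʳ : (x : Vec ℕ n) → x ⊕ 𝟘 ≡ x
⊕-identityʳ []      = refl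
⊕-identityʳ (a ∷ x) = cong₂ _∷_ (+-identityʳ a) (⊕-identityʳ x)

x≤x⊕y : (x y : Vec ℕ n) → x ≤ᵥ x ⊕ y
x≤x⊕y []      []      = []
x≤x⊕y (a ∷ x) (b ∷ y) = m≤m+n a b ∷ x≤x⊕y x y

⊕-monoʳ-≤ : ∀ (x : Vec ℕ n) {y z} → y ≤ᵥ z → x ⊕ y ≤ᵥ x ⊕ z
⊕-monoʳ-≤ []      []       = []
⊕-monoʳ-≤ (a ∷ x) (p ∷ ps) = +-monoʳ-≤ a p ∷ ⊕-monoʳ-≤ x ps

⊖-≤ : (x y : Vec ℕ n) → x ⊖ y ≤ᵥ x
⊖-≤ []      []      = []
⊖-≤ (a ∷ x) (b ∷ y) = m∸n≤m a b ∷ ⊖-≤ x y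

⊕-⊖ : {x y : Vec ℕ n} → x ≤ᵥ y → x ⊕ (y ⊖ x) ≡ y
⊕-⊖ []       = refl
⊕-⊖ (p ∷ ps) = cong₂ _∷_ (m+[n∸m]≡n p) (⊕-⊖ ps)

x⊕y≤z⇒x≤z⊖y : {x y z : Vec ℕ n} → x ⊕ y ≤ᵥ z → x ≤ᵥ z ⊖ y
x⊕y≤z⇒x≤z⊖y {x = []}    {[]}    {[]}    []       = []
x⊕y≤z⇒x≤z⊖y {x = a ∷ _} {_ ∷ _} {_ ∷ _} (p ∷ ps) = m+n≤o⇒m≤o∸n a p ∷ x⊕y≤z⇒x≤z⊖y ps

sum-⊕ : (x y : Vec ℕ n) → Vec.sum (x ⊕ y) ≡ Vec.sum x + Vec.sum y
sum-⊕ []      []      = refl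
sum-⊕ (a ∷ x) (b ∷ y) = trans (cong (a + b +_) (sum-⊕ x y)) (interchange a b _ _)
  where open CommSemigroup +-commutativeSemigroup using (interchange)

sum-⊖ : {x y : Vec ℕ n} → x ≤ᵥ y → Vec.sum x + Vec.sum (y ⊖ x) ≡ Vec.sum y
sum-⊖ {x = x} {y} x≤y = trans (sym (sum-⊕ x (y ⊖ x))) (cong Vec.sum (⊕-⊖ x≤y))

sum-𝟘 : ∀ n → Vec.sum (𝟘 {n}) ≡ 0
sum-𝟘 zero    = refl
sum-𝟘 (suc n) = sum-𝟘 n

sum-spike : ∀ k (i : Fin n) → Vec.sum (spike k i) ≡ k
sum-spike {suc n} k zero    = trans (cong (k +_) (sum-𝟘 n)) (+-identityʳ k)
sum-spike         k (suc i) = sum-spike k i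

-- `weightedSum` is the case `c = suc ∘ toℕ`; arbitrary coefficients let inductions on the vector
-- pass to `c ∘ suc`.
dot : (Fin n → ℕ) → Vec ℕ n → ℕ
dot c x = Vec.sum (Vec.tabulate λ i → c i * lookup x i)

dot-⊕ : ∀ (c : Fin n → ℕ) x y → dot c (x ⊕ y) ≡ dot c x + dot c y
dot-⊕ c []      []      = refl
dot-⊕ c (a ∷ x) (b ∷ y) = trans
  (cong₂ _+_ (*-distribˡ-+ (c zero) a b) (dot-⊕ (c ∘ suc) x y))
  (interchange (c zero * a) _ _ _)
  where open CommSemigroup +-commutativeSemigroup using (interchange)

dot-𝟘 : (c : Fin n → ℕ) → dot c 𝟘 ≡ 0
dot-𝟘 {zero}  c = refl
dot-𝟘 {suc n} c = cong₂ _+_ (*-zeroʳ (c zero)) (dot-𝟘 (c ∘ suc))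

dot-spike : ∀ (c : Fin n → ℕ) i → dot c (spike 1 i) ≡ c i
dot-spike c zero    = trans (cong₂ _+_ (*-identityʳ (c zero)) (dot-𝟘 (c ∘ suc))) (+-identityʳ _)
dot-spike c (suc i) = cong₂ _+_ (*-zeroʳ (c zero)) (dot-spike (c ∘ suc) i)

weightedSum-⊖ : {x y : Vec ℕ n} → x ≤ᵥ y → weightedSum y ≡ weightedSum x + weightedSum (y ⊖ x)
weightedSum-⊖ {x = x} {y} x≤y =
  trans (cong weightedSum (sym (⊕-⊖ x≤y))) (dot-⊕ (suc ∘ toℕ) x (y ⊖ x))

-- Supports, indicator vectors and chains of subvectors.

supp : Vec ℕ n → List (Fin n)
supp []          = []
supp (zero  ∷ x) = List.map suc (supp x)
supp (suc _ ∷ x) = zero ∷ List.map suc (supp x)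

length-supp : (x : Vec ℕ n) → length (supp x) ≡ σ x
length-supp []          = refl
length-supp (zero  ∷ x) = trans (length-map suc (supp x)) (length-supp x)
length-supp (suc _ ∷ x) = cong suc (trans (length-map suc (supp x)) (length-supp x))

supp-unique : (x : Vec ℕ n) → Unique (supp x)
supp-unique []          = []
supp-unique (zero  ∷ x) = Unique.map⁺ Fin.suc-injective (supp-unique x)
supp-unique (suc _ ∷ x) =
  All.tabulate (λ i∈ 0≡i → let _ , _ , i≡ = ∈-map⁻ suc i∈ in contradiction (trans 0≡i i≡) λ ())
  ∷ Unique.map⁺ Fin.suc-injective (supp-unique x)

indicator : Vec ℕ n → Vec ℕ n
indicator = Vec.map (1 ⊓_)

indicator-≤ : (x : Vec ℕ n) → indicator x ≤ᵥ x
indicator-≤ []      = []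
indicator-≤ (a ∷ x) = m⊓n≤n 1 a ∷ indicator-≤ x

sum-indicator : (x : Vec ℕ n) → Vec.sum (indicator x) ≡ σ x
sum-indicator []          = refl
sum-indicator (zero  ∷ x) = sum-indicator x
sum-indicator (suc _ ∷ x) = cong suc (sum-indicator x)

∈-supp⁻ : ∀ (x : Vec ℕ n) {i} → i ∈ supp x → 1 ≤ lookup (indicator x) i
∈-supp⁻ (zero  ∷ x) i∈ with _ , j∈ , refl ← ∈-map⁻ suc i∈ = ∈-supp⁻ x j∈
∈-supp⁻ (suc _ ∷ x) (here refl) = s≤s z≤n
∈-supp⁻ (suc _ ∷ x) (there i∈) with _ , j∈ , refl ← ∈-map⁻ suc i∈ = ∈-supp⁻ x j∈

spike⊕spike-≤ : ∀ {i j} (x : Vec ℕ n) → i ≢ j → 1 ≤ lookup x i → 1 ≤ lookup x j →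
                spike 1 i ⊕ spike 1 j ≤ᵥ x
spike⊕spike-≤ {i = zero}  {zero}  _       i≢j _ _ = contradiction refl i≢j
spike⊕spike-≤ {i = zero}  {suc j} (a ∷ x) _   p q =
  p ∷ subst (_≤ᵥ x) (sym (⊕-identityˡ _)) (spike-≤ 1 j x q)
spike⊕spike-≤ {i = suc i} {zero}  (a ∷ x) _   p q =
  q ∷ subst (_≤ᵥ x) (sym (⊕-identityʳ _)) (spike-≤ 1 i x p)
spike⊕spike-≤ {i = suc i} {suc j} (a ∷ x) i≢j p q =
  z≤n ∷ spike⊕spike-≤ x (i≢j ∘ cong suc) p q

-- A greedy maximal chain below d: the entries are filled from left to right.
fill : ℕ → Vec ℕ n → Vec ℕ n
fill t []      = []
fill t (a ∷ d) = t ⊓ a ∷ fill (t ∸ a) d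

fill-≤ : ∀ t (d : Vec ℕ n) → fill t d ≤ᵥ d
fill-≤ t []      = []
fill-≤ t (a ∷ d) = m⊓n≤n t a ∷ fill-≤ (t ∸ a) d

fill-mono : ∀ {s t} (d : Vec ℕ n) → s ≤ t → fill s d ≤ᵥ fill t d
fill-mono []      s≤t = []
fill-mono (a ∷ d) s≤t = ⊓-monoˡ-≤ a s≤t ∷ fill-mono d (∸-monoˡ-≤ a s≤t)

sum-fill : ∀ {t} (d : Vec ℕ n) → t ≤ Vec.sum d → Vec.sum (fill t d) ≡ t
sum-fill []      z≤n = refl
sum-fill {t = t} (a ∷ d) t≤ = trans
  (cong (t ⊓ a +_) (sum-fill d (m≤n+o⇒m∸n≤o t a t≤)))
  (trans (cong (_+ (t ∸ a)) (⊓-comm t a)) (m⊓n+n∸m≡n a t))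

sum-mono-≤ : {x y : Vec ℕ n} → x ≤ᵥ y → Vec.sum x ≤ Vec.sum y
sum-mono-≤ []       = z≤n
sum-mono-≤ (p ∷ ps) = +-mono-≤ p (sum-mono-≤ ps)

-- unit zero is 𝟘, so that the weight of unit i is i for every residue i modulo n + 1.
unit : Fin (suc n) → Vec ℕ n
unit zero    = 𝟘
unit (suc i) = spike 1 i

sum-unit-≤1 : (i : Fin (suc n)) → Vec.sum (unit i) ≤ 1
sum-unit-≤1 {n} zero    = ≤-trans (≤-reflexive (sum-𝟘 n)) z≤n
sum-unit-≤1     (suc i) = ≤-reflexive (sum-spike 1 i)

-- Of two distinct indices at most one is zero. Positivity ensures that u minus both units falls
-- short of x.
0<sum-units : {i j : Fin (suc n)} → i ≢ j → 0 < Vec.sum (unit i) + Vec.sum (unit j)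
0<sum-units {i = suc i}          _   = ≤-trans (≤-reflexive (sym (sum-spike 1 i))) (m≤m+n _ _)
0<sum-units {i = zero} {suc j}   _   = ≤-trans (≤-reflexive (sym (sum-spike 1 j))) (m≤n+m _ _)
0<sum-units {i = zero} {zero}    i≢j = contradiction refl i≢j

weightedSum-unit : (i : Fin (suc n)) → weightedSum (unit i) ≡ toℕ i
weightedSum-unit {n} zero    = dot-𝟘 {n} (suc ∘ toℕ)
weightedSum-unit     (suc i) = dot-spike (suc ∘ toℕ) i

-- Bounding width plus sum of an indecomposable solution.

module _ {n} {x : Vec ℕ n} (ind : Indecomposable (suc n) x) where

  open ≤-Reasoning

  private
    m s S : ℕ
    m = suc n
    s = σ x
    S = Vec.sum x

    u : Vec ℕ n
    u = indicator x

    s≤S : s ≤ S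
    s≤S = subst (_≤ S) (sum-indicator x) (sum-mono-≤ (indicator-≤ x))

  residue : Vec ℕ n → ℕ
  residue y = weightedSum y % m

  -- The difference of two subsums that agree modulo m is a solution below x.
  residue-distinct : ∀ {y z} → y ≤ᵥ z → z ≤ᵥ x → Vec.sum y < Vec.sum z →
                     Vec.sum z < S + Vec.sum y → residue y ≢ residue z
  residue-distinct {y} {z} y≤z z≤x y<z z<x+y eq = <⇒≢ z<x+y (sym (begin-equality
    S + Vec.sum y               ≡⟨ +-comm S _ ⟩
    Vec.sum y + S               ≡⟨ cong (λ v → Vec.sum y + Vec.sum v) z⊖y≡x ⟨
    Vec.sum y + Vec.sum (z ⊖ y) ≡⟨ sum-⊖ y≤z ⟩
    Vec.sum z                   ∎))
    where
    z⊖y≢𝟘 : z ⊖ y ≢ 𝟘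
    z⊖y≢𝟘 z⊖y≡𝟘 = <⇒≢ y<z (begin-equality
      Vec.sum y                   ≡⟨ +-identityʳ _ ⟨
      Vec.sum y + 0               ≡⟨ cong (Vec.sum y +_) (sum-𝟘 n) ⟨
      Vec.sum y + Vec.sum (𝟘 {n}) ≡⟨ cong (λ v → Vec.sum y + Vec.sum v) z⊖y≡𝟘 ⟨
      Vec.sum y + Vec.sum (z ⊖ y) ≡⟨ sum-⊖ y≤z ⟩
      Vec.sum z                   ∎)

    z⊖y≡x : z ⊖ y ≡ x
    z⊖y≡x = proj₂ (proj₂ ind) (z ⊖ y)
      ([m+n]%d≡m%d⇒d∣n (weightedSum y) _ m
        (trans (cong (_% m) (sym (weightedSum-⊖ y≤z))) (sym eq)))
      z⊖y≢𝟘 (≤ᵥ-trans (⊖-≤ z y) z≤x)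

  -- The extra leading 1 puts the index zero, that is the subvector `𝟘`, into the list, which thus
  -- has s + 1 members. Each index is also the residue of its unit.
  R : List (Fin m)
  R = supp (1 ∷ x)

  unit-≤ : ∀ {i} → i ∈ R → unit i ≤ᵥ u
  unit-≤ (here refl) = 𝟘≤ u
  unit-≤ (there i∈) with _ , j∈ , refl ← ∈-map⁻ suc i∈ = spike-≤ 1 _ u (∈-supp⁻ x j∈)

  unit⊕unit-≤ : ∀ {i j} → i ∈ R → j ∈ R → i ≢ j → unit i ⊕ unit j ≤ᵥ u
  unit⊕unit-≤ (here refl) j∈          _   = subst (_≤ᵥ u) (sym (⊕-identityˡ _)) (unit-≤ j∈)
  unit⊕unit-≤ i∈@(there _) (here refl) _  = subst (_≤ᵥ u) (sym (⊕-identityʳ _)) (unit-≤ i∈)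
  unit⊕unit-≤ (there i∈)  (there j∈)  i≢j
    with _ , i∈ , refl ← ∈-map⁻ suc i∈ | _ , j∈ , refl ← ∈-map⁻ suc j∈ =
    spike⊕spike-≤ u (i≢j ∘ cong suc) (∈-supp⁻ x i∈) (∈-supp⁻ x j∈)

  residue-unit : ∀ i → residue (unit i) ≡ toℕ i
  residue-unit i = trans (cong (_% m) (weightedSum-unit i)) (m<n⇒m%n≡m (toℕ<n i))

  mirror : Fin m → ℕ
  mirror i = residue (u ⊖ unit i)

  -- The weights of `unit i` and of its complement in u add up, so `mirror i` is c - i modulo m,
  -- where c is the residue of u.
  toℕ+mirror : ∀ {i} → i ∈ R → (toℕ i + mirror i) % m ≡ residue u
  toℕ+mirror {i} i∈ = begin-equality
    (toℕ i + mirror i) % m            ≡⟨ cong (λ r → (r + mirror i) % m) (residue-unit i) ⟨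
    (residue (unit i) + mirror i) % m ≡⟨ %-distribˡ-+ (weightedSum (unit i)) _ m ⟨
    _                                 ≡⟨ cong (_% m) (weightedSum-⊖ (unit-≤ i∈)) ⟨
    residue u                         ∎

  mirror-injective : ∀ {i j} → i ∈ R → j ∈ R → mirror i ≡ mirror j → i ≡ j
  mirror-injective {i} {j} i∈ j∈ eq = toℕ-injective (%-cancelʳ-< (mirror i) m (toℕ<n i) (toℕ<n j)
    (trans (toℕ+mirror i∈) (trans (sym (toℕ+mirror j∈)) (cong (λ r → (toℕ j + r) % m) (sym eq)))))

  sum-mirror : ∀ {i} → i ∈ R → Vec.sum (unit i) + Vec.sum (u ⊖ unit i) ≡ s
  sum-mirror i∈ = trans (sum-⊖ (unit-≤ i∈)) (sum-indicator x)

  -- This is `residue-distinct` for `unit i` below `u ⊖ unit j`. The two bounds on the sums say that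
  -- the difference, u minus both units, is neither zero nor all of x.
  toℕ≢mirror : ∀ {i j} → j ∈ R → unit i ⊕ unit j ≤ᵥ u →
               Vec.sum (unit i) + Vec.sum (unit j) < s →
               s < S + (Vec.sum (unit i) + Vec.sum (unit j)) → toℕ i ≢ mirror j
  toℕ≢mirror {i} {j} j∈ i⊕j≤u i+j<s s<S+i+j eq = residue-distinct
    (x⊕y≤z⇒x≤z⊖y i⊕j≤u)
    (≤ᵥ-trans (⊖-≤ u (unit j)) (indicator-≤ x))
    (+-cancelˡ-< (Vec.sum (unit j)) _ _ (begin-strict
      Vec.sum (unit j) + Vec.sum (unit i) ≡⟨ +-comm (Vec.sum (unit j)) _ ⟩
      Vec.sum (unit i) + Vec.sum (unit j) <⟨ i+j<s ⟩
      s                                   ≡⟨ sum-mirror j∈ ⟨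
      Vec.sum (unit j) + Vec.sum (u ⊖ unit j) ∎))
    (+-cancelˡ-< (Vec.sum (unit j)) _ _ (begin-strict
      Vec.sum (unit j) + Vec.sum (u ⊖ unit j)   ≡⟨ sum-mirror j∈ ⟩
      s                                         <⟨ s<S+i+j ⟩
      S + (Vec.sum (unit i) + Vec.sum (unit j)) ≡⟨ +-assoc S _ _ ⟨
      S + Vec.sum (unit i) + Vec.sum (unit j)   ≡⟨ +-comm _ (Vec.sum (unit j)) ⟩
      Vec.sum (unit j) + (S + Vec.sum (unit i)) ∎))
    (trans (residue-unit i) eq)

  -- The chain begins one step above u, hence `suc t`; restricting to `t < S ∸ suc s` stops it one
  -- step before x.
  above : ℕ → Vec ℕ n
  above t = u ⊕ fill (suc t) (x ⊖ u)

  above-≤ : ∀ t → above t ≤ᵥ x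
  above-≤ t = subst (above t ≤ᵥ_) (⊕-⊖ (indicator-≤ x)) (⊕-monoʳ-≤ u (fill-≤ (suc t) (x ⊖ u)))

  sum-above : ∀ {t} → t < S ∸ suc s → Vec.sum (above t) ≡ s + suc t
  sum-above {t} t< = trans (sum-⊕ u _) (cong₂ _+_ (sum-indicator x) (sum-fill (x ⊖ u)
    (+-cancelˡ-≤ s _ _ (begin
      s + suc t             ≤⟨ +-monoʳ-≤ s t< ⟩
      s + (S ∸ suc s)       ≤⟨ +-monoʳ-≤ s (∸-monoʳ-≤ S (n≤1+n s)) ⟩
      s + (S ∸ s)           ≡⟨ m+[n∸m]≡n s≤S ⟩
      S                     ≡⟨ sum-⊖ (indicator-≤ x) ⟨
      Vec.sum u + Vec.sum (x ⊖ u) ≡⟨ cong (_+ Vec.sum (x ⊖ u)) (sum-indicator x) ⟩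
      s + Vec.sum (x ⊖ u)   ∎))))

  sum-above-< : ∀ {t} → t < S ∸ suc s → Vec.sum (above t) < S
  sum-above-< {t} t< = begin-strict
    Vec.sum (above t) ≡⟨ sum-above t< ⟩
    s + suc t         ≡⟨ +-suc s t ⟩
    suc s + t         <⟨ +-monoʳ-< (suc s) t< ⟩
    suc s + (S ∸ suc s) ≡⟨ m+[n∸m]≡n {suc s} (<⇒≤ (m∸n≢0⇒n<m (m<n⇒n≢0 t<))) ⟩
    S ∎

  above-distinct : ∀ {y t} → y ≤ᵥ u → t < S ∸ suc s → residue y ≢ residue (above t)
  above-distinct {y} {t} y≤u t< = residue-distinct (≤ᵥ-trans y≤u (x≤x⊕y u _)) (above-≤ t)
    (begin-strict
      Vec.sum y ≤⟨ sum-mono-≤ y≤u ⟩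
      Vec.sum u ≡⟨ sum-indicator x ⟩
      s         <⟨ m<m+n s z<s ⟩
      s + suc t ≡⟨ sum-above t< ⟨
      Vec.sum (above t) ∎)
    (<-≤-trans (sum-above-< t<) (m≤m+n S _))

  -- The s + 1 residues in `R`, the mirror images of `K` and those of the `S ∸ suc s` chain vectors
  -- are pairwise distinct, and all lie below m.
  pigeonhole : ∀ {K} → Unique K → K ⊆ R → (∀ {i j} → i ∈ R → j ∈ K → toℕ i ≢ mirror j) →
               suc s + (length K + (S ∸ suc s)) ≤ m
  pigeonhole {K} K! K⊆R toℕ≢mirror = begin
    suc s + (length K + (S ∸ suc s))
      ≡⟨ cong₂ _+_ (trans (length-map toℕ R) (length-supp (1 ∷ x)))
           (cong₂ _+_ (length-map mirror K) (length-applyUpTo (residue ∘ above) _)) ⟨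
    length lows + (length mirrors + length aboves)
      ≡⟨ trans (length-++ lows) (cong (length lows +_) (length-++ mirrors)) ⟨
    length (lows ++ mirrors ++ aboves)
      ≤⟨ Unique∧⊆⇒length≤
           (Unique.++⁺ (Unique.map⁺ toℕ-injective (supp-unique (1 ∷ x)))
             (Unique.++⁺ (map⁺-∈ mirror (λ i∈ j∈ → mirror-injective (K⊆R i∈) (K⊆R j∈)) K!)
                         aboves! mirrors#aboves)
             lows#rest)
           residues<m ⟩
    length (upTo m)
      ≡⟨ length-upTo m ⟩
    m ∎
    where
    lows mirrors aboves : List ℕ
    lows    = List.map toℕ R
    mirrors = List.map mirror K
    aboves  = applyUpTo (residue ∘ above) (S ∸ suc s)

    aboves! : Unique aboves
    aboves! = Unique.applyUpTo⁺₁ (residue ∘ above) _ λ {i} {j} i<j j< → residue-distinct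
      (⊕-monoʳ-≤ u (fill-mono (x ⊖ u) (s≤s (<⇒≤ i<j)))) (above-≤ j)
      (subst₂ _<_ (sym (sum-above (<-trans i<j j<))) (sym (sum-above j<)) (+-monoʳ-< s (s<s i<j)))
      (<-≤-trans (sum-above-< j<) (m≤m+n S _))

    mirrors#aboves : Disjoint mirrors aboves
    mirrors#aboves (r∈mirrors , r∈aboves)
      with j , _ , refl ← ∈-map⁻ mirror r∈mirrors
         | _ , t< , eq ← ∈-applyUpTo⁻ (residue ∘ above) r∈aboves =
      above-distinct (⊖-≤ u (unit j)) t< eq

    lows#rest : Disjoint lows (mirrors ++ aboves)
    lows#rest (r∈lows , r∈rest) with i , i∈ , refl ← ∈-map⁻ toℕ r∈lows | ∈-++⁻ mirrors r∈rest
    ... | inj₁ r∈mirrors = let _ , j∈ , eq = ∈-map⁻ mirror r∈mirrors in toℕ≢mirror i∈ j∈ eq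
    ... | inj₂ r∈aboves  = let _ , t< , eq = ∈-applyUpTo⁻ (residue ∘ above) r∈aboves in
      above-distinct (unit-≤ i∈) t< (trans (residue-unit i) eq)

    residues<m : lows ++ mirrors ++ aboves ⊆ upTo m
    residues<m r∈ with ∈-++⁻ lows r∈
    ... | inj₁ r∈lows with i , _ , refl ← ∈-map⁻ toℕ r∈lows = ∈-upTo⁺ (toℕ<n i)
    ... | inj₂ r∈rest with ∈-++⁻ mirrors r∈rest
    ...   | inj₁ r∈mirrors with j , _ , refl ← ∈-map⁻ mirror r∈mirrors =
      ∈-upTo⁺ (m%n<n (weightedSum (u ⊖ unit j)) m)
    ...   | inj₂ r∈aboves with t , _ , refl ← ∈-applyUpTo⁻ (residue ∘ above) r∈aboves =
      ∈-upTo⁺ (m%n<n (weightedSum (above t)) m)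

  -- A choice of indices whose mirror images are new residues. Of the s + 1 indices two may be lost,
  -- so at least s - 1 are demanded.
  Mirrors : Set
  Mirrors = ∃ λ K → Unique K × K ⊆ R × s ≤ suc (length K) ×
                    (∀ {i j} → i ∈ R → j ∈ K → toℕ i ≢ mirror j)

  -- i is its own mirror image iff 2i is the weight of u modulo m, which has at most two solutions.
  mirrors : 3 ≤ s → Mirrors
  mirrors 3≤s = K , Unique.filter⁺ (¬? ∘ self?) R! , K⊆R , large , apart
    where
    self? : ∀ i → Dec (toℕ i ≡ mirror i)
    self? i = toℕ i ≟ mirror i

    R! : Unique R
    R! = supp-unique (1 ∷ x)

    K selves : List (Fin m)
    K      = filter (¬? ∘ self?) R
    selves = filter self? R

    K⊆R : K ⊆ R
    K⊆R i∈ = proj₁ (∈-filter⁻ (¬? ∘ self?) {xs = R} i∈)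

    selves≤2 : length selves ≤ 2
    selves≤2 = length-halves≤2 (residue u) m (Unique.filter⁺ self? R!) λ {i} i∈ →
      let i∈R , self = ∈-filter⁻ self? {xs = R} i∈ in
      trans (cong (λ r → (toℕ i + r) % m) self) (toℕ+mirror i∈R)

    large : s ≤ suc (length K)
    large = s≤s⁻¹ (begin
      suc s                    ≡⟨ length-supp (1 ∷ x) ⟨
      length R                 ≡⟨ length-filter-∁ self? R ⟨
      length selves + length K ≤⟨ +-monoˡ-≤ (length K) selves≤2 ⟩
      2 + length K             ∎)

    apart : ∀ {i j} → i ∈ R → j ∈ K → toℕ i ≢ mirror j
    apart {i} {j} i∈ j∈ eq = toℕ≢mirror j∈R (unit⊕unit-≤ i∈ j∈R i≢j)
      (≤-trans (s≤s (+-mono-≤ (sum-unit-≤1 i) (sum-unit-≤1 j))) 3≤s)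
      (≤-<-trans s≤S (m<m+n S (0<sum-units i≢j))) eq
      where
      j∈R : j ∈ R
      j∈R = K⊆R j∈
      i≢j : i ≢ j
      i≢j refl = proj₂ (∈-filter⁻ (¬? ∘ self?) {xs = R} j∈) eq

  -- For s at most 1 no mirror image is demanded, and for s = 2 only one is. The index zero supplies
  -- it: its mirror image is that of u itself, a proper part of x because s < S.
  mirrors-narrow : s < 3 → s < S → Mirrors
  mirrors-narrow s<3 s<S with s ≤? 1
  ... | yes s≤1 = [] , [] , (λ ()) , s≤1 , λ _ ()
  ... | no  s≰1 = zero ∷ [] , All.[] ∷ [] , K⊆R , s≤s⁻¹ s<3 , apart
    where
    K⊆R : zero ∷ [] ⊆ R
    K⊆R (here refl) = here refl

    apart : ∀ {i j} → i ∈ R → j ∈ zero ∷ [] → toℕ i ≢ mirror j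
    apart {i} i∈ (here refl) = toℕ≢mirror (here refl)
      (subst (_≤ᵥ u) (sym (⊕-identityʳ _)) (unit-≤ i∈))
      (≤-<-trans (+-mono-≤ (sum-unit-≤1 i) (≤-reflexive (sum-𝟘 n))) (≰⇒> s≰1))
      (<-≤-trans s<S (m≤m+n S _))

  -- For s < S the pigeonhole counts at least (s + 1) + (s - 1) + (S - s - 1) = s + S - 1 residues.
  -- For s = S the chain is empty and the count is at least 2s = s + S, one better.
  width-bound : 4 ≤ m → s + S ≤ suc m × (s ≡ S → s + S ≤ m)
  width-bound 4≤m with m≤n⇒m<n∨m≡n s≤S
  ... | inj₁ s<S = large (case-narrow (3 ≤? s)) , λ s≡S → contradiction s≡S (<⇒≢ s<S)
    where
    case-narrow : Dec (3 ≤ s) → Mirrors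
    case-narrow (yes 3≤s) = mirrors 3≤s
    case-narrow (no  3≰s) = mirrors-narrow (≰⇒> 3≰s) s<S

    large : Mirrors → s + S ≤ suc m
    large (K , K! , K⊆R , s≤1+K , apart) = begin
      s + S                                  ≤⟨ +-monoˡ-≤ S s≤1+K ⟩
      suc (length K + S)                     ≡⟨ cong (λ t → suc (length K + t)) (m+[n∸m]≡n s<S) ⟨
      suc (length K + (suc s + (S ∸ suc s))) ≡⟨ cong suc (x∙yz≈y∙xz (length K) (suc s) _) ⟩
      suc (suc s + (length K + (S ∸ suc s))) ≤⟨ s≤s (pigeonhole K! K⊆R apart) ⟩
      suc m                                  ∎
      where open CommSemigroup +-commutativeSemigroup using (x∙yz≈y∙xz)
  ... | inj₂ s≡S = m≤n⇒m≤1+n (tight (3 ≤? s)) , λ _ → tight (3 ≤? s)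
    where
    tight : Dec (3 ≤ s) → s + S ≤ m
    tight (yes 3≤s) with K , K! , K⊆R , s≤1+K , apart ← mirrors 3≤s = begin
      s + S                            ≡⟨ cong (s +_) s≡S ⟨
      s + s                            ≤⟨ +-monoʳ-≤ s s≤1+K ⟩
      s + suc (length K)               ≡⟨ +-suc s _ ⟩
      suc s + length K                 ≤⟨ +-monoʳ-≤ (suc s) (m≤m+n _ _) ⟩
      suc s + (length K + (S ∸ suc s)) ≤⟨ pigeonhole K! K⊆R apart ⟩
      m                                ∎
    -- Here s = S is at most 2, and `4≤m` settles the bound without counting residues.
    tight (no 3≰s) = begin
      s + S ≡⟨ cong (s +_) s≡S ⟨
      s + s ≤⟨ +-mono-≤ s≤2 s≤2 ⟩
      4     ≤⟨ 4≤m ⟩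
      m     ∎
      where
      s≤2 : s ≤ 2
      s≤2 = s≤s⁻¹ (≰⇒> 3≰s)

-- Moving a vector within its support.

raise : ℕ → Vec ℕ n → Vec ℕ n
raise t []          = []
raise t (zero  ∷ x) = zero ∷ raise t x
raise t (suc a ∷ x) = suc (t + a) ∷ x

σ-raise : ∀ t (x : Vec ℕ n) → σ (raise t x) ≡ σ x
σ-raise t []          = refl
σ-raise t (zero  ∷ x) = σ-raise t x
σ-raise t (suc a ∷ x) = refl

sum-raise : ∀ t (x : Vec ℕ n) → 0 < σ x → Vec.sum (raise t x) ≡ t + Vec.sum x
sum-raise t (zero  ∷ x) 0<σ = sum-raise t x 0<σ
sum-raise t (suc a ∷ x) _   = trans (cong suc (+-assoc t a _)) (sym (+-suc t _))

raise-≥ : ∀ t (x : Vec ℕ n) → x ≤ᵥ raise t x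
raise-≥ t []          = []
raise-≥ t (zero  ∷ x) = z≤n ∷ raise-≥ t x
raise-≥ t (suc a ∷ x) = s≤s (m≤n+m a t) ∷ ≤ᵥ-refl

-- The raised entry is the first nonzero one in both vectors, so x and y agree elsewhere, and the
-- entry raised by more was the smaller one.
raise-cancel-≤ : ∀ {s t} {x y : Vec ℕ n} → s ≤ t → raise s x ≡ raise t y → y ≤ᵥ x
raise-cancel-≤ {x = []}        {[]}        _   _  = []
raise-cancel-≤ {x = zero ∷ _}  {zero ∷ _}  s≤t eq =
  z≤n ∷ raise-cancel-≤ s≤t (proj₂ (∷-injective eq))
raise-cancel-≤ {s = s} {t} {suc a ∷ x} {suc b ∷ y} s≤t eq with eq₁ , refl ← ∷-injective eq =
  s≤s (+-cancelˡ-≤ t b a (≤-trans (≤-reflexive (suc-injective (sym eq₁))) (+-monoˡ-≤ a s≤t)))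
  ∷ ≤ᵥ-refl

-- Only an entry of at least 2 is decreased, so that the support is preserved.
lower : Vec ℕ n → Vec ℕ n
lower []                = []
lower (0 ∷ x)           = 0 ∷ lower x
lower (1 ∷ x)           = 1 ∷ lower x
lower (suc (suc a) ∷ x) = suc a ∷ x

σ-lower : (x : Vec ℕ n) → σ (lower x) ≡ σ x
σ-lower []                = refl
σ-lower (0 ∷ x)           = σ-lower x
σ-lower (1 ∷ x)           = cong suc (σ-lower x)
σ-lower (suc (suc a) ∷ x) = refl

-- A sum exceeding the width forces some entry to be at least 2; i is the position of the first such
-- entry.
lower⊕spike : (x : Vec ℕ n) → σ x < Vec.sum x → ∃ λ i → lower x ⊕ spike 1 i ≡ x
lower⊕spike (0 ∷ x) p with i , eq ← lower⊕spike x p         = suc i , cong (0 ∷_) eq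
lower⊕spike (1 ∷ x) p with i , eq ← lower⊕spike x (s<s⁻¹ p) = suc i , cong (1 ∷_) eq
lower⊕spike (suc (suc a) ∷ x) p = zero , cong₂ _∷_ (cong suc (+-comm a 1)) (⊕-identityʳ x)

sum-lower : (x : Vec ℕ n) → σ x < Vec.sum x → suc (Vec.sum (lower x)) ≡ Vec.sum x
sum-lower x σ<sum with i , eq ← lower⊕spike x σ<sum = begin
  suc (Vec.sum (lower x))                 ≡⟨ +-comm 1 _ ⟩
  Vec.sum (lower x) + 1                   ≡⟨ cong (Vec.sum (lower x) +_) (sum-spike 1 i) ⟨
  Vec.sum (lower x) + Vec.sum (spike 1 i) ≡⟨ sum-⊕ (lower x) (spike 1 i) ⟨
  Vec.sum (lower x ⊕ spike 1 i)           ≡⟨ cong Vec.sum eq ⟩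
  Vec.sum x                               ∎
  where open ≡-Reasoning

lower-≤ : (x : Vec ℕ n) → lower x ≤ᵥ x
lower-≤ []                = []
lower-≤ (0 ∷ x)           = z≤n ∷ lower-≤ x
lower-≤ (1 ∷ x)           = ≤-refl ∷ lower-≤ x
lower-≤ (suc (suc a) ∷ x) = n≤1+n (suc a) ∷ ≤ᵥ-refl

-- The lowered coordinate is recovered from the weight of lower x modulo n + 1.
lower-injective : ∀ {x y : Vec ℕ n} → Solution (suc n) x → Solution (suc n) y →
                  σ x < Vec.sum x → σ y < Vec.sum y → lower x ≡ lower y → x ≡ y
lower-injective {n} {x} {y} x-sol y-sol σx< σy< eq
  with i , x≡ ← lower⊕spike x σx< | j , y≡ ← lower⊕spike y σy< = begin
  x                     ≡⟨ x≡ ⟨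
  lower x ⊕ spike 1 i   ≡⟨ cong₂ (λ v k → v ⊕ spike 1 k) eq i≡j ⟩
  lower y ⊕ spike 1 j   ≡⟨ y≡ ⟩
  y                     ∎
  where
  open ≡-Reasoning

  vanishes : ∀ {z} k → lower z ⊕ spike 1 k ≡ z → Solution (suc n) z →
             (suc (toℕ k) + weightedSum (lower z)) % suc n ≡ 0
  vanishes {z} k eq z-sol = begin
    (suc (toℕ k) + weightedSum (lower z)) % suc n
      ≡⟨ cong (_% suc n) (+-comm (suc (toℕ k)) _) ⟩
    (weightedSum (lower z) + suc (toℕ k)) % suc n
      ≡⟨ cong (λ w → (weightedSum (lower z) + w) % suc n) (dot-spike (suc ∘ toℕ) k) ⟨
    (weightedSum (lower z) + weightedSum (spike 1 k)) % suc n
      ≡⟨ cong (_% suc n) (dot-⊕ (suc ∘ toℕ) (lower z) (spike 1 k)) ⟨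
    weightedSum (lower z ⊕ spike 1 k) % suc n
      ≡⟨ cong (λ v → weightedSum v % suc n) eq ⟩
    weightedSum z % suc n
      ≡⟨ n∣m⇒m%n≡0 _ (suc n) z-sol ⟩
    0 ∎

  i≡j : i ≡ j
  i≡j = toℕ-injective (suc-injective (%-cancelʳ-< (weightedSum (lower x)) (suc n)
    (s<s (toℕ<n i)) (s<s (toℕ<n j)) (begin
      (suc (toℕ i) + weightedSum (lower x)) % suc n ≡⟨ vanishes i x≡ x-sol ⟩
      0                                             ≡⟨ vanishes j y≡ y-sol ⟨
      (suc (toℕ j) + weightedSum (lower y)) % suc n
        ≡⟨ cong (λ v → (suc (toℕ j) + weightedSum v) % suc n) eq ⟨
      (suc (toℕ j) + weightedSum (lower x)) % suc n ∎)))

σ≢0 : (x : Vec ℕ n) → x ≢ 𝟘 → 0 < σ x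
σ≢0 []          x≢𝟘 = contradiction refl x≢𝟘
σ≢0 (zero  ∷ x) x≢𝟘 = σ≢0 x (x≢𝟘 ∘ cong (0 ∷_))
σ≢0 (suc _ ∷ x) _   = z<s

indecomposable-antichain : ∀ m {x y} → Indecomposable m x → Indecomposable m y → x ≤ᵥ y → x ≡ y
indecomposable-antichain _ (x-sol , x≢𝟘 , _) (_ , _ , minimal) = minimal _ x-sol x≢𝟘

-- Moves an indecomposable solution of width s to the layer of vectors of width s and
-- sum m − s, one step down if its sum is m − s + 1 and up otherwise.
level : ℕ → Vec ℕ n → Vec ℕ n
level m x with σ x + Vec.sum x ≤? m
... | yes _ = raise (m ∸ (σ x + Vec.sum x)) x
... | no  _ = lower x

σ-level : ∀ m (x : Vec ℕ n) → σ (level m x) ≡ σ x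
σ-level m x with σ x + Vec.sum x ≤? m
... | yes _ = σ-raise _ x
... | no  _ = σ-lower x

module _ (4≤1+n : 4 ≤ suc n) where

  private
    m : ℕ
    m = suc n

  excess⇒σ<sum : ∀ {x : Vec ℕ n} → Indecomposable m x → ¬ σ x + Vec.sum x ≤ m → σ x < Vec.sum x
  excess⇒σ<sum {x} ind excess = ≤∧≢⇒< σ≤sum
    (excess ∘ proj₂ (width-bound ind 4≤1+n))
    where
    σ≤sum : σ x ≤ Vec.sum x
    σ≤sum = subst (_≤ Vec.sum x) (sum-indicator x) (sum-mono-≤ (indicator-≤ x))

  sum-level : ∀ {x : Vec ℕ n} → Indecomposable m x → Vec.sum (level m x) ≡ m ∸ σ x
  sum-level {x} ind with σ x + Vec.sum x ≤? m
  ... | yes low = begin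
    Vec.sum (raise (m ∸ (σ x + Vec.sum x)) x)
      ≡⟨ sum-raise _ x (σ≢0 x (proj₁ (proj₂ ind))) ⟩
    m ∸ (σ x + Vec.sum x) + Vec.sum x
      ≡⟨ cong (_+ Vec.sum x) (∸-+-assoc m (σ x) _) ⟨
    m ∸ σ x ∸ Vec.sum x + Vec.sum x
      ≡⟨ m∸n+n≡m (m+n≤o⇒m≤o∸n (Vec.sum x) (subst (_≤ m) (+-comm (σ x) _) low)) ⟩
    m ∸ σ x ∎
    where open ≡-Reasoning
  -- The width bound leaves s + S = m + 1 as the only possibility, so lowering by one reaches sum m
  -- - s exactly.
  ... | no excess = begin
    Vec.sum (lower x)                   ≡⟨ m+n∸m≡n (σ x) _ ⟨
    σ x + Vec.sum (lower x) ∸ σ x       ≡⟨ cong (_∸ σ x) (suc-injective (begin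
      suc (σ x + Vec.sum (lower x))       ≡⟨ +-suc (σ x) _ ⟨
      σ x + suc (Vec.sum (lower x))       ≡⟨ cong (σ x +_) (sum-lower x (excess⇒σ<sum ind excess)) ⟩
      σ x + Vec.sum x                     ≡⟨ ≤-antisym (proj₁ (width-bound ind 4≤1+n)) (≰⇒> excess) ⟩
      suc m                               ∎)) ⟩
    m ∸ σ x                             ∎
    where open ≡-Reasoning

  -- Two raised vectors with equal images are comparable, and a raised x with the same image as a
  -- lowered y lies below y; the antichain property settles both cases. Two lowered vectors are
  -- separated by their weights.
  level-injective : ∀ {x y : Vec ℕ n} → Indecomposable m x → Indecomposable m y →
                    level m x ≡ level m y → x ≡ y
  level-injective {x} {y} x-ind y-ind eq with σ x + Vec.sum x ≤? m | σ y + Vec.sum y ≤? m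
  ... | yes _ | yes _ =
    [ (λ s≤t → sym (indecomposable-antichain m y-ind x-ind (raise-cancel-≤ s≤t eq)))
    , (λ t≤s → indecomposable-antichain m x-ind y-ind (raise-cancel-≤ t≤s (sym eq)))
    ]′ (≤-total (m ∸ (σ x + Vec.sum x)) (m ∸ (σ y + Vec.sum y)))
  ... | yes _ | no  _ = indecomposable-antichain m x-ind y-ind
    (≤ᵥ-trans (subst (x ≤ᵥ_) eq (raise-≥ _ x)) (lower-≤ y))
  ... | no  _ | yes _ = sym (indecomposable-antichain m y-ind x-ind
    (≤ᵥ-trans (subst (y ≤ᵥ_) (sym eq) (raise-≥ _ y)) (lower-≤ x)))
  ... | no x-excess | no y-excess =
    lower-injective (proj₁ x-ind) (proj₁ y-ind)
      (excess⇒σ<sum x-ind x-excess) (excess⇒σ<sum y-ind y-excess) eq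

-- Enumerating the vectors of given width and sum.

mutual
  layer : ∀ n (s t : ℕ) → List (Vec ℕ n)
  layer zero    zero zero = [] ∷ []
  layer zero    _    _    = []
  layer (suc n) s    t    = List.map (0 ∷_) (layer n s t) ++ positiveHead n s t

  -- The vectors of length n + 1 in the layer whose first entry is positive: that entry is 1, or it
  -- is one more than a positive entry.
  positiveHead : ∀ n (s t : ℕ) → List (Vec ℕ (suc n))
  positiveHead n (suc s) (suc t) =
    List.map (1 ∷_) (layer n s t) ++
    List.map (λ v → suc (Vec.head v) ∷ Vec.tail v) (positiveHead n (suc s) t)
  positiveHead n _ _ = []

∈-positiveHead : ∀ a (v : Vec ℕ n) → v ∈ layer n (σ v) (Vec.sum v) →
                 suc a ∷ v ∈ positiveHead n (suc (σ v)) (suc a + Vec.sum v)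
∈-positiveHead zero    v v∈ = ∈-++⁺ˡ (∈-map⁺ (1 ∷_) v∈)
∈-positiveHead (suc a) v v∈ = ∈-++⁺ʳ _ (∈-map⁺ _ (∈-positiveHead a v v∈))

∈-layer : (v : Vec ℕ n) → v ∈ layer n (σ v) (Vec.sum v)
∈-layer []          = here refl
∈-layer (zero  ∷ v) = ∈-++⁺ˡ (∈-map⁺ (0 ∷_) (∈-layer v))
∈-layer {suc n} (suc a ∷ v) =
  ∈-++⁺ʳ (List.map (0 ∷_) (layer n _ _)) (∈-positiveHead a v (∈-layer v))

-- The number of compositions of t into s positive parts.
compositions : (s t : ℕ) → ℕ
compositions zero    zero    = 1
compositions zero    (suc t) = 0
compositions (suc s) zero    = 0
compositions (suc s) (suc t) = t C s

-- Both sides count the compositions of t + 1 into s + 1 parts, the left side according to whether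
-- the first part is 1 or larger.
compositions-suc : ∀ s t → compositions s t + compositions (suc s) t ≡ t C s
compositions-suc zero    zero    = refl
compositions-suc zero    (suc t) = refl
compositions-suc (suc s) zero    = refl
compositions-suc (suc s) (suc t) = nCk+nC[k+1]≡[n+1]C[k+1] t s

mutual
  -- The support is chosen in `n C s` ways and then filled by a composition of t. Zero and positive
  -- first entries combine by Pascal's rule.
  length-layer : ∀ n s t → length (layer n s t) ≡ (n C s) * compositions s t
  length-layer zero    zero    zero    = refl
  length-layer zero    zero    (suc _) = refl
  length-layer zero    (suc _) _       = refl
  length-layer (suc n) zero    t       = begin
    _                              ≡⟨ length-++ (List.map (0 ∷_) (layer n zero t)) ⟩
    _                              ≡⟨ +-identityʳ _ ⟩
    _                              ≡⟨ length-map (0 ∷_) (layer n zero t) ⟩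
    length (layer n zero t)        ≡⟨ length-layer n zero t ⟩
    (suc n C 0) * compositions 0 t   ∎
    where open ≡-Reasoning
  length-layer (suc n) (suc s) t = begin
    _ ≡⟨ length-++ (List.map (0 ∷_) (layer n (suc s) t)) ⟩
    length (List.map (0 ∷_) (layer n (suc s) t)) + length (positiveHead n (suc s) t)
      ≡⟨ cong₂ _+_ (trans (length-map (0 ∷_) (layer n (suc s) t)) (length-layer n (suc s) t))
                   (length-positiveHead n s t) ⟩
    (n C suc s) * c + (n C s) * c ≡⟨ *-distribʳ-+ c (n C suc s) (n C s) ⟨
    (n C suc s + n C s) * c
      ≡⟨ cong (_* c) (trans (+-comm (n C suc s) _) (nCk+nC[k+1]≡[n+1]C[k+1] n s)) ⟩
    (suc n C suc s) * c         ∎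
    where
    open ≡-Reasoning
    c = compositions (suc s) t

  length-positiveHead : ∀ n s t → length (positiveHead n (suc s) t) ≡ (n C s) * compositions (suc s) t
  length-positiveHead n s zero    = sym (*-zeroʳ (n C s))
  length-positiveHead n s (suc t) = begin
    _ ≡⟨ length-++ (List.map (1 ∷_) (layer n s t)) ⟩
    _ ≡⟨ cong₂ _+_ (trans (length-map (1 ∷_) (layer n s t)) (length-layer n s t))
                   (trans (length-map _ (positiveHead n (suc s) t)) (length-positiveHead n s t)) ⟩
    (n C s) * compositions s t + (n C s) * compositions (suc s) t
      ≡⟨ *-distribˡ-+ (n C s) (compositions s t) _ ⟨
    (n C s) * (compositions s t + compositions (suc s) t)
      ≡⟨ cong ((n C s) *_) (compositions-suc s t) ⟩
    (n C s) * (t C s) ∎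
    where open ≡-Reasoning

-- Bounding `ℓ` by the sizes of the layers.

length-concat-applyUpTo : ∀ (f : ℕ → List A) k →
                          length (concat (applyUpTo f k)) ≡ sum (applyUpTo (length ∘ f) k)
length-concat-applyUpTo f zero    = refl
length-concat-applyUpTo f (suc k) =
  trans (length-++ (f 0)) (cong (length (f 0) +_) (length-concat-applyUpTo (f ∘ suc) k))

sum-applyUpTo-mono : ∀ {f g} k → (∀ i → f i ≤ g i) → sum (applyUpTo f k) ≤ sum (applyUpTo g k)
sum-applyUpTo-mono zero    f≤g = z≤n
sum-applyUpTo-mono (suc k) f≤g = +-mono-≤ (f≤g 0) (sum-applyUpTo-mono k (f≤g ∘ suc))

σ≤SD : ∀ m {x} → x ∈ indecomposables m → σ x ≤ SD m
σ≤SD m x∈ = All.lookup (xs≤max 0 (List.map σ (indecomposables m))) (∈-map⁺ σ x∈)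

ℓ≤ : ∀ n → 4 ≤ suc n → ℓ (suc n) ≤
     sum (applyUpTo (λ s → (n C suc s) * compositions (suc s) (n ∸ s)) (SD (suc n)))
ℓ≤ n 4≤m = begin
  ℓ (suc n)
    ≤⟨ injective⇒length≤ (level (suc n))
         (λ x∈ y∈ → level-injective 4≤m (indecomposable x∈) (indecomposable y∈))
         (indecomposables-unique (suc n)) level∈ ⟩
  length (concat (applyUpTo layers (SD (suc n))))
    ≡⟨ length-concat-applyUpTo layers (SD (suc n)) ⟩
  sum (applyUpTo (length ∘ layers) (SD (suc n)))
    ≤⟨ sum-applyUpTo-mono (SD (suc n)) (λ s → ≤-reflexive (length-layer n (suc s) (n ∸ s))) ⟩
  sum (applyUpTo (λ s → (n C suc s) * compositions (suc s) (n ∸ s)) (SD (suc n))) ∎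
  where
  open ≤-Reasoning

  -- The index is shifted: `layers s` has width s + 1 and sum m - (s + 1) = n - s, where m = n + 1.
  layers : ℕ → List (Vec ℕ n)
  layers s = layer n (suc s) (n ∸ s)

  indecomposable : ∀ {x} → x ∈ indecomposables (suc n) → Indecomposable (suc n) x
  indecomposable = Equivalence.to (∈-indecomposables⇔ (suc n))

  ∈-layers : ∀ {v} s → 0 < s → s ≤ SD (suc n) → v ∈ layer n s (suc n ∸ s) →
             v ∈ concat (applyUpTo layers (SD (suc n)))
  ∈-layers (suc s) _ s<SD v∈ = ∈-concat⁺′ v∈ (∈-applyUpTo⁺ layers s<SD)

  level∈ : ∀ {x} → x ∈ indecomposables (suc n) →
           level (suc n) x ∈ concat (applyUpTo layers (SD (suc n)))
  level∈ {x} x∈ = ∈-layers (σ x) (σ≢0 x (proj₁ (proj₂ (indecomposable x∈)))) (σ≤SD (suc n) x∈)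
    (subst₂ (λ s t → level (suc n) x ∈ layer n s t) (σ-level (suc n) x)
      (sum-level 4≤m (indecomposable x∈)) (∈-layer (level (suc n) x)))

-- Trinomial coefficients as products of binomial coefficients.

[p+q]Cp*p!*q! : ∀ p q → ((p + q) C p) * (p ! * q !) ≡ (p + q) !
[p+q]Cp*p!*q! p q = begin
  ((p + q) C p) * (p ! * q !)
    ≡⟨ cong (λ r → ((p + q) C p) * (p ! * r !)) (m+n∸m≡n p q) ⟨
  ((p + q) C p) * d
    ≡⟨ cong (_* d) (nCk≡n!/k![n-k]! (m≤m+n p q)) ⟩
  (p + q) ! / d * d
    ≡⟨ m/n*n≡m (k![n∸k]!∣n! (m≤m+n p q)) ⟩
  (p + q) ! ∎
  where
  open ≡-Reasoning
  d : ℕ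
  d = p ! * (p + q ∸ p) !
  instance
    _ = p !* (p + q ∸ p) !≢0

trinomial≡C*C : ∀ p q r → trinomial (p + q + r) p q r ≡ ((p + q + r) C p) * ((q + r) C q)
trinomial≡C*C p q r with p + q + r ≟ p + q + r
... | no  ≢    = contradiction refl ≢
... | yes _    = begin
  (p + q + r) ! / d ≡⟨ cong (_/ d) factorial ⟩
  a * b * d / d     ≡⟨ m*n/n≡m (a * b) d ⟩
  a * b             ∎
  where
  open ≡-Reasoning
  open CommSemigroup *-commutativeSemigroup using (x∙yz≈y∙xz)
  a b d : ℕ
  a = (p + q + r) C p
  b = (q + r) C q
  d = p ! * q ! * r !
  instance
    _ = m*n≢0 (p ! * q !) (r !) {{p !* q !≢0}} {{r !≢0}}

  factorial : (p + q + r) ! ≡ a * b * d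
  factorial = begin
    (p + q + r) !                        ≡⟨ cong _! (+-assoc p q r) ⟩
    (p + (q + r)) !                      ≡⟨ [p+q]Cp*p!*q! p (q + r) ⟨
    ((p + (q + r)) C p) * (p ! * (q + r) !)
      ≡⟨ cong₂ (λ n k → (n C p) * (p ! * k)) (+-assoc p q r) ([p+q]Cp*p!*q! q r) ⟨
    a * (p ! * (b * (q ! * r !)))        ≡⟨ cong (a *_) (x∙yz≈y∙xz (p !) b _) ⟩
    a * (b * (p ! * (q ! * r !)))        ≡⟨ *-assoc a b _ ⟨
    a * b * (p ! * (q ! * r !))          ≡⟨ cong (a * b *_) (*-assoc (p !) (q !) (r !)) ⟨
    a * b * d                            ∎

compositions≡0 : ∀ {s t} → t ≤ s → compositions (suc s) t ≡ 0
compositions≡0 {t = zero}  _   = refl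
compositions≡0 {t = suc t} t<s = k>n⇒nCk≡0 t<s

2*[1+s]+r : ∀ s r → 2 * suc s + r ≡ suc (suc s + s + r)
2*[1+s]+r s r =
  cong (λ k → suc (k + r)) (trans (+-suc s (s + 0)) (cong (λ k → suc (s + k)) (+-identityʳ s)))

-- If 2(s + 1) is at most n + 1, both sides are equal. Otherwise n - s is at most s and has no
-- composition into s + 1 positive parts, so the left side vanishes.
C*compositions≤trinomial : ∀ n s → (n C suc s) * compositions (suc s) (n ∸ s) ≤
                           trinomial n (suc s) s (suc n ∸ 2 * suc s)
C*compositions≤trinomial n s with 2 * suc s ≤? suc n
... | no 2[1+s]≰1+n = ≤-trans (≤-reflexive (trans
    (cong ((n C suc s) *_) (compositions≡0 (m≤n+o⇒m∸n≤o n s n≤s+s))) (*-zeroʳ (n C suc s)))) z≤n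
  where
  n≤s+s : n ≤ s + s
  n≤s+s = s≤s⁻¹ (s≤s⁻¹ (subst (suc (suc n) ≤_)
    (cong suc (trans (+-suc s (s + 0)) (cong (λ k → suc (s + k)) (+-identityʳ s)))) (≰⇒> 2[1+s]≰1+n)))
-- With r = n + 1 - 2(s + 1), the number n becomes (s + 1) + s + r, the shape required by
-- `trinomial≡C*C`.
... | yes 2[1+s]≤1+n with r , eq ← m≤n⇒∃[o]m+o≡n 2[1+s]≤1+n
                     with refl ← suc-injective (trans (sym (2*[1+s]+r s r)) eq) = ≤-reflexive (begin
  ((suc s + s + r) C suc s) * compositions (suc s) (suc s + s + r ∸ s)
    ≡⟨ cong (λ t → ((suc s + s + r) C suc s) * compositions (suc s) t) rest ⟩
  ((suc s + s + r) C suc s) * ((s + r) C s)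
    ≡⟨ trinomial≡C*C (suc s) s r ⟨
  trinomial (suc s + s + r) (suc s) s r
    ≡⟨ cong (trinomial (suc s + s + r) (suc s) s)
         (trans (cong (_∸ 2 * suc s) (sym eq)) (m+n∸m≡n (2 * suc s) r)) ⟨
  trinomial (suc s + s + r) (suc s) s (suc (suc s + s + r) ∸ 2 * suc s) ∎)
  where
  open ≡-Reasoning

  rest : suc s + s + r ∸ s ≡ suc (s + r)
  rest = trans
    (cong (_∸ s) (trans (cong (_+ r) (sym (+-suc s s))) (+-assoc s (suc s) r)))
    (m+n∸m≡n s (suc (s + r)))

-- Comparison with a power of three.

nCk≤2^n : ∀ n k → n C k ≤ 2 ^ n
nCk≤2^n n       zero    = m^n>0 2 n
nCk≤2^n zero    (suc k) = z≤n
nCk≤2^n (suc n) (suc k) = begin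
  suc n C suc k       ≡⟨ nCk+nC[k+1]≡[n+1]C[k+1] n k ⟨
  n C k + n C suc k   ≤⟨ +-mono-≤ (nCk≤2^n n k) (nCk≤2^n n (suc k)) ⟩
  2 ^ n + 2 ^ n       ≡⟨ cong (2 ^ n +_) (+-identityʳ (2 ^ n)) ⟨
  2 ^ suc n           ∎
  where open ≤-Reasoning

compositions≤2^ : ∀ n s → compositions (suc s) (n ∸ s) ≤ 2 ^ (n ∸ suc s)
-- Writing `n ∸ suc s` as the predecessor of `n ∸ s` lets one case split reduce both sides.
compositions≤2^ n s rewrite sym (pred[m∸n]≡m∸[1+n] n s) with n ∸ s
... | zero  = z≤n
... | suc t = nCk≤2^n t s

sum-applyUpTo-+ : ∀ f g k →
                  sum (applyUpTo (λ i → f i + g i) k) ≡ sum (applyUpTo f k) + sum (applyUpTo g k)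
sum-applyUpTo-+ f g zero    = refl
sum-applyUpTo-+ f g (suc k) = trans
  (cong (f 0 + g 0 +_) (sum-applyUpTo-+ (f ∘ suc) (g ∘ suc) k))
  (interchange (f 0) (g 0) _ _)
  where open CommSemigroup +-commutativeSemigroup using (interchange)

sum-applyUpTo-* : ∀ c f k → sum (applyUpTo (λ i → c * f i) k) ≡ c * sum (applyUpTo f k)
sum-applyUpTo-* c f zero    = sym (*-zeroʳ c)
sum-applyUpTo-* c f (suc k) = trans
  (cong (c * f 0 +_) (sum-applyUpTo-* c (f ∘ suc) k)) (sym (*-distribˡ-+ c (f 0) _))

C*2^ : (n p : ℕ) → ℕ
C*2^ n p = (n C p) * 2 ^ (n ∸ p)

-- Termwise form of (1 + 2)^(n+1) = (1 + 2)(1 + 2)^n, by Pascal's rule.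
C*2^-suc : ∀ n p → C*2^ (suc n) (suc p) ≤ C*2^ n p + 2 * C*2^ n (suc p)
C*2^-suc n p = begin
  (suc n C suc p) * 2 ^ (n ∸ p)
    ≡⟨ cong (_* 2 ^ (n ∸ p)) (nCk+nC[k+1]≡[n+1]C[k+1] n p) ⟨
  (n C p + n C suc p) * 2 ^ (n ∸ p)
    ≡⟨ *-distribʳ-+ (2 ^ (n ∸ p)) (n C p) _ ⟩
  C*2^ n p + (n C suc p) * 2 ^ (n ∸ p)
    ≤⟨ +-monoʳ-≤ (C*2^ n p) doubled ⟩
  C*2^ n p + 2 * C*2^ n (suc p) ∎
  where
  open ≤-Reasoning
  open CommSemigroup *-commutativeSemigroup using (x∙yz≈y∙xz)

  doubled : (n C suc p) * 2 ^ (n ∸ p) ≤ 2 * C*2^ n (suc p)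
  doubled with suc p ≤? n
  ... | yes p<n = begin
    (n C suc p) * 2 ^ (n ∸ p)             ≡⟨ cong (λ e → (n C suc p) * 2 ^ e) (+-∸-assoc 1 p<n) ⟩
    (n C suc p) * (2 * 2 ^ (n ∸ suc p))   ≡⟨ x∙yz≈y∙xz (n C suc p) 2 _ ⟩
    2 * C*2^ n (suc p)                    ∎
  -- For p at least n the exponents are truncated, but the binomial coefficient is 0.
  ... | no  p≮n = ≤-trans (≤-reflexive (cong (_* 2 ^ (n ∸ p)) (k>n⇒nCk≡0 (≰⇒> p≮n)))) z≤n

-- A partial sum of the binomial expansion of (1 + 2)ⁿ.
ΣC*2^≤3^n : ∀ n k → sum (applyUpTo (C*2^ n) k) ≤ 3 ^ n
ΣC*2^≤3^n n       zero    = z≤n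
ΣC*2^≤3^n zero    (suc k) = s≤s (≤-reflexive (sum-applyUpTo-* 0 (λ _ → 0) k))
ΣC*2^≤3^n (suc n) (suc k) = begin
  C*2^ (suc n) 0 + sum (applyUpTo (C*2^ (suc n) ∘ suc) k)
    ≤⟨ +-mono-≤ (≤-reflexive head) (sum-applyUpTo-mono k (C*2^-suc n)) ⟩
  2 * C*2^ n 0 + sum (applyUpTo (λ p → C*2^ n p + 2 * C*2^ n (suc p)) k)
    ≡⟨ cong (2 * C*2^ n 0 +_) (trans (sum-applyUpTo-+ (C*2^ n) _ k)
         (cong (sum (applyUpTo (C*2^ n) k) +_) (sum-applyUpTo-* 2 (C*2^ n ∘ suc) k))) ⟩
  2 * C*2^ n 0 + (sum (applyUpTo (C*2^ n) k) + 2 * sum (applyUpTo (C*2^ n ∘ suc) k))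
    ≡⟨ x∙yz≈y∙xz (2 * C*2^ n 0) (sum (applyUpTo (C*2^ n) k)) _ ⟩
  sum (applyUpTo (C*2^ n) k) + (2 * C*2^ n 0 + 2 * sum (applyUpTo (C*2^ n ∘ suc) k))
    ≡⟨ cong (sum (applyUpTo (C*2^ n) k) +_) (*-distribˡ-+ 2 (C*2^ n 0) _) ⟨
  sum (applyUpTo (C*2^ n) k) + 2 * sum (applyUpTo (C*2^ n) (suc k))
    ≤⟨ +-mono-≤ (ΣC*2^≤3^n n k) (*-monoʳ-≤ 2 (ΣC*2^≤3^n n (suc k))) ⟩
  3 ^ n + 2 * 3 ^ n
    ≡⟨⟩
  3 ^ suc n ∎
  where
  open ≤-Reasoning
  open CommSemigroup +-commutativeSemigroup using (x∙yz≈y∙xz)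

  head : C*2^ (suc n) 0 ≡ 2 * C*2^ n 0
  head = trans (*-identityˡ (2 * 2 ^ n)) (cong (2 *_) (sym (*-identityˡ (2 ^ n))))

ℓ<3^n : ∀ n → 4 ≤ suc n → ℓ (suc n) < 3 ^ n
ℓ<3^n n 4≤m = begin-strict
  ℓ (suc n)
    ≤⟨ ℓ≤ n 4≤m ⟩
  sum (applyUpTo (λ s → (n C suc s) * compositions (suc s) (n ∸ s)) (SD (suc n)))
    ≤⟨ sum-applyUpTo-mono (SD (suc n)) (λ s → *-monoʳ-≤ (n C suc s) (compositions≤2^ n s)) ⟩
  sum (applyUpTo (C*2^ n ∘ suc) (SD (suc n)))
    -- Strictness comes from restoring the term of index 0, which is 2^n.
    <⟨ m<n+m _ (subst (0 <_) (sym (*-identityˡ (2 ^ n))) (m^n>0 2 n)) ⟩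
  sum (applyUpTo (C*2^ n) (suc (SD (suc n))))
    ≤⟨ ΣC*2^≤3^n n (suc (SD (suc n))) ⟩
  3 ^ n ∎
  where open ≤-Reasoning

theorem2 : (∀ (m : ℕ) → 4 ≤ m →
    ℓ m ≤ sumFrom1To (SD m) (λ s → trinomial (m ∸ 1) s (s ∸ 1) (m ∸ 2 * s)))
    × (∀ (m : ℕ) → 2 ≤ m → ℓ m < 3 ^ (m ∸ 1))
theorem2 = trinomial-bound , power-bound
  where
  trinomial-bound : ∀ (m : ℕ) → 4 ≤ m →
    ℓ m ≤ sumFrom1To (SD m) (λ s → trinomial (m ∸ 1) s (s ∸ 1) (m ∸ 2 * s))
  trinomial-bound (suc n) 4≤m =
    ≤-trans (ℓ≤ n 4≤m) (sum-applyUpTo-mono (SD (suc n)) (C*compositions≤trinomial n))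

  power-bound : ∀ (m : ℕ) → 2 ≤ m → ℓ m < 3 ^ (m ∸ 1)
  power-bound 1 (s≤s ())
  -- The layer bound requires m to be at least 4; the cases m = 2 and m = 3 are decided by
  -- evaluating `ℓ`.
  power-bound 2 _ = toWitness {a? = ℓ 2 <? 3} _
  power-bound 3 _ = toWitness {a? = ℓ 3 <? 9} _
  power-bound (suc (suc (suc (suc k)))) _ = ℓ<3^n (3 + k) (m≤m+n 4 k)
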